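{- Let $n$ and $s$ be positive integers, let $L=\{\ell_1,\ell_2,\ldots,\ell_s\}$ be a set of $s$ distinct non-negative integers, and let $\mathcal{F}\subseteq 2^{[n]}$ be an $L$-intersecting Sperner family. Then $$|\mathcal{F}|\le \sum_{i=0}^{s}\binom{n-1}{i}.$$ Moreover, if $0\in L$ and $n\ge 3s^2$, then $|\mathcal{F}|\le\binom{n}{s}$, with equality if and only if $L=\{0,1,2,\ldots,s-1\}$ and $\mathcal{F}=\binom{[n]}{s}$.
   Context: $[n]=\{1,\ldots,n\}$ and $2^{[n]}$ is the family of all subsets of $[n]$; $\binom{[n]}{s}$ is the family of all $s$-element subsets of $[n]$. A family $\mathcal{F}\subseteq 2^{[n]}$ is $L$-intersecting if $|F\cap F'|\in L$ for any two distinct $F,F'\in\mathcal{F}$. A family $\mathcal{F}$ is Sperner if there are no distinct $A,B\in\mathcal{F}$ with $A\subseteq B$. -}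

module Defs where

open import Data.Nat using (ℕ; suc; _∸_)
open import Data.Nat.Combinatorics using (_C_)
open import Data.List using (List; map; upTo)
open import Data.Nat.ListAction using (sum)
open import Data.List.Membership.Propositional using (_∈_)
open import Data.Fin.Subset using (Subset; _∩_; _⊆_; ∣_∣)
open import Relation.Binary.PropositionalEquality using (_≢_)
open import Relation.Nullary using (¬_)

-- A family F ⊆ 2^[n] is represented as a duplicate-free list of subsets of Fin n.
-- L-intersecting: |A ∩ B| ∈ L for any two distinct members A, B of F.
LIntersecting : ∀ {n} → List ℕ → List (Subset n) → Set
LIntersecting L F = ∀ {A B} → A ∈ F → B ∈ F → A ≢ B → ∣ A ∩ B ∣ ∈ L

Sperner : ∀ {n} → List (Subset n) → Set
Sperner F = ∀ {A B} → A ∈ F → B ∈ F → A ≢ B → ¬ (A ⊆ B)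

sumBinom : ℕ → ℕ → ℕ
sumBinom m s = sum (map (λ i → m C i) (upTo (suc s)))

{-# OPTIONS --safe #-}

-- For the first bound, restrict f_A(x) = ∏ (|A ∩ x| - l), over l ∈ L with l < |A|, to the
-- sets x containing a fixed point. The Sperner condition makes the evaluations of the f_A at
-- the members of F triangular with nonzero diagonal once the A avoiding that point come
-- first, and a polynomial of degree ≤ s in n-1 variables is determined by its values on the
-- sets of size ≤ s.
--
-- If every l ∈ L is < s, the second bound is a LYM inequality: a member A of size ≤ s claims
-- the maximal chains through it, a larger one those whose s-th set lies in A. Each member
-- claims at least s!(n-s)! chains, with equality only if |A| = s. If some l ∈ L is ≥ s, the
-- members of size ≤ s use at most s-1 values; those of size > s are counted through the links
-- of points, which also use at most s-1 values since 0 is lost. The total is < C(n, s).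
module Submission where

open import Defs
import Algebra.Properties.CommutativeMonoid.Sum as Sum
open import Data.Bool.Base using (Bool; if_then_else_; _∧_)
import Data.Bool.Properties as Bool
open import Data.Fin.Base using (Fin; zero; suc)
open import Data.Fin.Subset using (Subset; ∣_∣; _∩_; _⊆_; inside; outside; ⊥)
open import Data.Fin.Subset.Properties
  using (∩-comm; ∩-idem; ∣p∣≤n; ∣p∩q∣≤∣p∣; out⊆; in⊆in; ⊆-antisym; ∣⊥∣≡0)
open import Data.Integer.Base as ℤ using (ℤ; 0ℤ; 1ℤ) renaming (+_ to pos)
import Data.Integer.Properties as ℤ
import Data.Integer.Tactic.RingSolver as ℤ-Ring
open import Data.List.Base using (List; []; _∷_; _++_; length; map; filter; upTo)
open import Data.List.Properties
  using (length-++; length-map; length-filter; filter-notAll; length-upTo; upTo-∷ʳ; map-++; map-∘; map-cong-local)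
import Data.List.Membership.DecPropositional as DecMembership
open import Data.List.Membership.Propositional using (_∈_; _∉_; lose; find)
open import Data.List.Membership.Propositional.Properties
  using (∈-filter⁺; ∈-filter⁻; ∈-∃++; ∈-++⁻; ∈-++⁺ˡ; ∈-++⁺ʳ; ∈-map⁺; ∈-map⁻; ∈-upTo⁺)
open import Data.List.Relation.Unary.All as All using (All; []; _∷_)
import Data.List.Relation.Unary.All.Properties as All
open import Data.List.Relation.Unary.AllPairs as AllPairs using (AllPairs; []; _∷_)
import Data.List.Relation.Unary.AllPairs.Properties as AllPairs
open import Data.List.Relation.Unary.Any using (here; there)
open import Data.List.Relation.Unary.Unique.Propositional using (Unique)
import Data.List.Relation.Unary.Unique.Propositional.Properties as Unique
open import Data.Nat.Base
open import Data.Nat.Combinatorics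
  using (_C_; nCk+nC[k+1]≡[n+1]C[k+1]; nC1≡n; nCk≡n!/k![n-k]!; k![n∸k]!∣n!)
open import Data.Nat.DivMod using (m/n*n≡m)
open import Data.Nat.ListAction using (sum)
open import Data.Nat.ListAction.Properties using (sum-++)
open import Data.Nat.Properties as ℕ hiding (_≟_)
import Data.Nat.Tactic.RingSolver as ℕ-Ring
open import Data.Product.Base using (_×_; _,_; proj₁; proj₂; ∃-syntax)
open import Data.Sum.Base using (_⊎_; inj₁; inj₂; [_,_]′)
open import Data.Unit.Base using (⊤; tt)
open import Data.Vec.Base using ([]; _∷_; head; tail; lookup; removeAt)
open import Data.Vec.Properties using (lookup-zipWith; ∷-injectiveʳ; ≡-dec)
open import Function.Base using (_∘_; const; id)
open import Function.Bundles using (_⇔_; mk⇔; Equivalence)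
open import Relation.Binary.Definitions using (Symmetric; tri<; tri≈; tri>)
open import Relation.Binary.PropositionalEquality
open import Relation.Nullary using (yes; no; ¬_; contradiction; ¬?)
open import Relation.Nullary.Decidable using (decidable-stable)
open import Relation.Unary using (Decidable)

open Sum +-0-commutativeMonoid using (∑-distrib-+; sum-replicate-zero; sum-cong-≗) renaming (sum to ∑)

-- Functions of bounded degree on the cube

∂ : ∀ {n} → (Subset (suc n) → ℤ) → Subset n → ℤ
∂ f x = f (inside ∷ x) ℤ.- f (outside ∷ x)

-- Multilinear polynomials of degree < t, via discrete derivatives.
Degree< : ∀ {n} → ℕ → (Subset n → ℤ) → Set
Degree< zero f = ∀ x → f x ≡ 0ℤ
Degree< {zero} (suc t) f = ⊤
Degree< {suc n} (suc t) f = Degree< (suc t) (f ∘ (outside ∷_)) × Degree< t (∂ f)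

-- `h` is tied to the combination only pointwise, so that restrictions and derivatives can be fed in
-- without function extensionality.
degree<-linear : ∀ {n} t {f g h : Subset n → ℤ} a b → Degree< t f → Degree< t g →
                 (∀ x → h x ≡ a ℤ.* f x ℤ.+ b ℤ.* g x) → Degree< t h
degree<-linear zero a b f0 g0 h≡ x =
  trans (h≡ x) (trans (cong₂ (λ u v → a ℤ.* u ℤ.+ b ℤ.* v) (f0 x) (g0 x)) (zeros a b))
  where
  zeros : ∀ a b → a ℤ.* 0ℤ ℤ.+ b ℤ.* 0ℤ ≡ 0ℤ
  zeros = ℤ-Ring.solve-∀
degree<-linear {zero} (suc t) a b _ _ _ = tt
degree<-linear {suc n} (suc t) a b (df , df′) (dg , dg′) h≡ =
  degree<-linear (suc t) a b df dg (h≡ ∘ (outside ∷_)) ,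
  degree<-linear t a b df′ dg′ λ x →
    trans (cong₂ ℤ._-_ (h≡ (inside ∷ x)) (h≡ (outside ∷ x))) (regroup a b _ _ _ _)
  where
  regroup : ∀ a b f₁ g₁ f₀ g₀ → (a ℤ.* f₁ ℤ.+ b ℤ.* g₁) ℤ.- (a ℤ.* f₀ ℤ.+ b ℤ.* g₀)
            ≡ a ℤ.* (f₁ ℤ.- f₀) ℤ.+ b ℤ.* (g₁ ℤ.- g₀)
  regroup = ℤ-Ring.solve-∀

degree<-suc : ∀ {n} t {f : Subset n → ℤ} → Degree< t f → Degree< (suc t) f
degree<-suc {zero} t _ = tt
degree<-suc {suc n} zero f0 =
  degree<-suc zero (f0 ∘ (outside ∷_)) ,
  λ x → cong₂ ℤ._-_ (f0 (inside ∷ x)) (f0 (outside ∷ x))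
degree<-suc {suc n} (suc t) (df , df′) = degree<-suc (suc t) df , degree<-suc t df′

degree<-const : ∀ {n} c → Degree< {n} 1 (const c)
degree<-const {zero} c = tt
degree<-const {suc n} c = degree<-const c , λ x → ℤ.+-inverseʳ c

-- By the discrete Leibniz rule: if the first element lies in `A`, the derivative of f·u is ∂f·u +
-- ∂f + f, with u and f taken at the sets avoiding that element. Otherwise the linear factor u does
-- not see the element and passes through the derivative.
degree<-* : ∀ {n} t {f h : Subset n → ℤ} A c → Degree< t f →
            (∀ x → h x ≡ f x ℤ.* ((pos ∣ A ∩ x ∣) ℤ.+ c)) → Degree< (suc t) h
degree<-* zero A c f0 h≡ =
  degree<-suc zero λ x → trans (h≡ x) (cong (ℤ._* ((pos ∣ A ∩ x ∣) ℤ.+ c)) (f0 x))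
degree<-* {zero} (suc t) A c df h≡ = tt
degree<-* {suc n} (suc t) {f} (outside ∷ A) c (df , df′) h≡ =
  degree<-* (suc t) A c df (h≡ ∘ (outside ∷_)) ,
  degree<-* t A c df′ λ x →
    trans (cong₂ ℤ._-_ (h≡ (inside ∷ x)) (h≡ (outside ∷ x)))
          (sym (factor (f (inside ∷ x)) (f (outside ∷ x)) ((pos ∣ A ∩ x ∣) ℤ.+ c)))
  where
  factor : ∀ f₁ f₀ u → (f₁ ℤ.- f₀) ℤ.* u ≡ f₁ ℤ.* u ℤ.- f₀ ℤ.* u
  factor = ℤ-Ring.solve-∀
degree<-* {suc n} (suc t) {f} (inside ∷ A) c (df , df′) h≡ =
  degree<-* (suc t) A c df (h≡ ∘ (outside ∷_)) ,
  degree<-linear (suc t) 1ℤ 1ℤ (degree<-* t A c df′ (λ _ → refl))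
    (degree<-linear (suc t) 1ℤ 1ℤ (degree<-suc t df′) df (λ _ → refl)) λ x →
      trans (cong₂ ℤ._-_ (h≡ (inside ∷ x)) (h≡ (outside ∷ x)))
            (leibniz (f (inside ∷ x)) (f (outside ∷ x)) (pos ∣ A ∩ x ∣) c)
  where
  leibniz : ∀ f₁ f₀ u c → f₁ ℤ.* ((1ℤ ℤ.+ u) ℤ.+ c) ℤ.- f₀ ℤ.* (u ℤ.+ c)
            ≡ 1ℤ ℤ.* ((f₁ ℤ.- f₀) ℤ.* (u ℤ.+ c)) ℤ.+ 1ℤ ℤ.* (1ℤ ℤ.* (f₁ ℤ.- f₀) ℤ.+ 1ℤ ℤ.* f₀)
  leibniz = ℤ-Ring.solve-∀

-- The sets of size strictly below `t`, to match the strict bound in `Degree<`.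
smallSets : ∀ n → ℕ → List (Subset n)
smallSets n zero = []
smallSets zero (suc t) = [] ∷ []
smallSets (suc n) (suc t) = map (outside ∷_) (smallSets n (suc t)) ++ map (inside ∷_) (smallSets n t)

-- Induction on the first element. Once `f` is zero on all sets avoiding it, the derivative at a
-- small set `p` is just the value at `inside ∷ p`, so the derivative vanishes on the sets of size
-- below `t - 1` and hence everywhere.
degree<-vanishing : ∀ {n} t {f : Subset n → ℤ} → Degree< t f →
                    All (λ p → f p ≡ 0ℤ) (smallSets n t) → ∀ x → f x ≡ 0ℤ
degree<-vanishing zero f0 _ = f0
degree<-vanishing {zero} (suc t) _ (f[]≡0 ∷ []) [] = f[]≡0
degree<-vanishing {suc n} (suc t) {f} (df , df′) f≡0 = vanish
  where
  onOut : ∀ x → f (outside ∷ x) ≡ 0ℤ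
  onOut = degree<-vanishing (suc t) df
    (All.map⁻ (All.++⁻ˡ (map (outside ∷_) (smallSets n (suc t))) f≡0))

  ∂≡0 : ∀ x → ∂ f x ≡ 0ℤ
  ∂≡0 = degree<-vanishing t df′
    (All.map (λ {x} e → cong₂ ℤ._-_ e (onOut x))
      (All.map⁻ (All.++⁻ʳ (map (outside ∷_) (smallSets n (suc t))) f≡0)))

  vanish : ∀ x → f x ≡ 0ℤ
  vanish (outside ∷ x) = onOut x
  vanish (inside ∷ x) = trans (ℤ.i-j≡0⇒i≡j _ _ (∂≡0 x)) (onOut x)

-- Partial sums of binomial coefficients

-- The range is i < t, while that of sumBinom n t is i ≤ t.
binomSum : ℕ → ℕ → ℕ
binomSum n zero = 0
binomSum n (suc t) = binomSum n t + n C t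

binomSum-zero : ∀ t → binomSum 0 (suc t) ≡ 1
binomSum-zero zero = refl
binomSum-zero (suc t) = trans (+-identityʳ _) (binomSum-zero t)

binomSum-suc : ∀ n t → binomSum (suc n) (suc t) ≡ binomSum n (suc t) + binomSum n t
binomSum-suc n zero = refl
binomSum-suc n (suc t) = begin
  binomSum (suc n) (suc t) + suc n C suc t
    ≡⟨ cong₂ _+_ (binomSum-suc n t) (sym (nCk+nC[k+1]≡[n+1]C[k+1] n t)) ⟩
  (binomSum n (suc t) + binomSum n t) + (n C t + n C suc t)
    ≡⟨ swap (binomSum n (suc t)) (binomSum n t) (n C t) (n C suc t) ⟩
  binomSum n (suc (suc t)) + binomSum n (suc t) ∎
  where
  open ≡-Reasoning
  swap : ∀ a b c d → (a + b) + (c + d) ≡ (a + d) + (b + c)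
  swap = ℕ-Ring.solve-∀

binomSum-mono : ∀ n {s t} → s ≤ t → binomSum n s ≤ binomSum n t
binomSum-mono n = go ∘ ≤⇒≤′
  where
  go : ∀ {s t} → s ≤′ t → binomSum n s ≤ binomSum n t
  go ≤′-refl = ≤-refl
  go (≤′-step s≤t) = ≤-trans (go s≤t) (m≤m+n _ _)

sumBinom≡binomSum : ∀ n t → sumBinom n t ≡ binomSum n (suc t)
sumBinom≡binomSum n t = go (suc t)
  where
  open ≡-Reasoning
  go : ∀ t → sum (map (n C_) (upTo t)) ≡ binomSum n t
  go zero = refl
  go (suc t) = begin
    sum (map (n C_) (upTo (suc t)))              ≡⟨ cong (sum ∘ map (n C_)) (upTo-∷ʳ t) ⟨
    sum (map (n C_) (upTo t ++ t ∷ []))          ≡⟨ cong sum (map-++ (n C_) (upTo t) (t ∷ [])) ⟩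
    sum (map (n C_) (upTo t) ++ n C t ∷ [])      ≡⟨ sum-++ (map (n C_) (upTo t)) (n C t ∷ []) ⟩
    sum (map (n C_) (upTo t)) + (n C t + 0)      ≡⟨ cong₂ _+_ (go t) (+-identityʳ (n C t)) ⟩
    binomSum n t + n C t                         ∎

length-smallSets : ∀ n t → length (smallSets n t) ≡ binomSum n t
length-smallSets n zero = refl
length-smallSets zero (suc t) = sym (binomSum-zero t)
length-smallSets (suc n) (suc t) = begin
  length (map (outside ∷_) (smallSets n (suc t)) ++ map (inside ∷_) (smallSets n t))
    ≡⟨ length-++ (map (outside ∷_) (smallSets n (suc t))) ⟩
  length (map (outside ∷_) (smallSets n (suc t))) + length (map (inside ∷_) (smallSets n t))
    ≡⟨ cong₂ _+_ (trans (length-map _ (smallSets n (suc t))) (length-smallSets n (suc t)))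
                 (trans (length-map _ (smallSets n t)) (length-smallSets n t)) ⟩
  binomSum n (suc t) + binomSum n t
    ≡⟨ binomSum-suc n t ⟨
  binomSum (suc n) (suc t) ∎
  where open ≡-Reasoning

-- The linear algebra bound for triangular systems

module _ {X : Set} where

  -- The function space is a predicate `V`, so that elimination can pass to a subspace by adding a
  -- condition `f p ≡ 0ℤ`.
  Triangular : ((X → ℤ) → Set) → List ((X → ℤ) × X) → Set
  Triangular V fs = All (λ (f , x) → V f × f x ≢ 0ℤ) fs × AllPairs (λ (f , _) (_ , y) → f y ≡ 0ℤ) fs

  -- All that elimination asks of a linear space; the two coefficients allow cross-multiplication in
  -- place of division over ℤ.
  SubtractionClosed : ((X → ℤ) → Set) → Set
  SubtractionClosed V = ∀ {f g} a b → V f → V g → V (λ x → a ℤ.* f x ℤ.- b ℤ.* g x)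

  -- One step of Gaussian elimination. The first function not vanishing at `p` becomes the pivot `f`
  -- and is dropped; those before it already vanish at `p`. Since `f` is zero at all later points,
  -- clearing the value at `p` merely scales the later functions there by `f p ≢ 0ℤ`, so the
  -- triangular shape survives. The last component carries the zeros of a kept head over to the
  -- reduced tail.
  eliminate : ∀ {V} → SubtractionClosed V → ∀ p fs → Triangular V fs →
              ∃[ gs ] Triangular (λ f → V f × f p ≡ 0ℤ) gs × length fs ≤ suc (length gs) ×
                (∀ {Q : X → Set} → All (Q ∘ proj₂) fs → All (Q ∘ proj₂) gs)
  eliminate V- p [] _ = [] , ([] , []) , z≤n , λ _ → []
  eliminate {V} V- p ((f , x) ∷ fs) ((vf , fx≢0) ∷ vfs , f≡0 ∷ tri) with f p ℤ.≟ 0ℤ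
  ... | yes fp≡0 =
    let (gs , (vgs , tri′) , len , sub) = eliminate V- p fs (vfs , tri)
    in (f , x) ∷ gs , (((vf , fp≡0) , fx≢0) ∷ vgs , sub f≡0 ∷ tri′) , s≤s len ,
       λ { (q ∷ qs) → q ∷ sub qs }
  ... | no fp≢0 =
    map reduce fs ,
    (All.map⁺ (All.zipWith reduced (vfs , f≡0)) ,
     AllPairs.map⁺ (reducedPairs fs f≡0 tri)) ,
    ≤-reflexive (cong suc (sym (length-map reduce fs))) ,
    λ { (_ ∷ qs) → All.map⁺ qs }
    where
    reduce : (X → ℤ) × X → (X → ℤ) × X
    reduce (g , y) = (λ z → f p ℤ.* g z ℤ.- g p ℤ.* f z) , y

    cancel : ∀ a b → a ℤ.* b ℤ.- b ℤ.* a ≡ 0ℤ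
    cancel = ℤ-Ring.solve-∀

    minusZero : ∀ a b c → a ℤ.* b ℤ.- c ℤ.* 0ℤ ≡ a ℤ.* b
    minusZero = ℤ-Ring.solve-∀

    reducedAt : ∀ {g : X → ℤ} {z} → f z ≡ 0ℤ → f p ℤ.* g z ℤ.- g p ℤ.* f z ≡ f p ℤ.* g z
    reducedAt {g} {z} fz≡0 =
      trans (cong (λ w → f p ℤ.* g z ℤ.- g p ℤ.* w) fz≡0) (minusZero (f p) (g z) (g p))

    reduced : ∀ {gy : (X → ℤ) × X} →
              (V (proj₁ gy) × proj₁ gy (proj₂ gy) ≢ 0ℤ) × f (proj₂ gy) ≡ 0ℤ →
              (V (proj₁ (reduce gy)) × proj₁ (reduce gy) p ≡ 0ℤ) × proj₁ (reduce gy) (proj₂ gy) ≢ 0ℤ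
    reduced {g , y} ((vg , gy≢0) , fy≡0) =
      (V- (f p) (g p) vg vf , cancel (f p) (g p)) ,
      λ e → [ fp≢0 , gy≢0 ]′ (ℤ.i*j≡0⇒i≡0∨j≡0 (f p) (trans (sym (reducedAt {g} fy≡0)) e))

    reducedPairs : ∀ gs → All (λ gy → f (proj₂ gy) ≡ 0ℤ) gs →
                   AllPairs (λ (g , _) (_ , y) → g y ≡ 0ℤ) gs →
                   AllPairs (λ gy hz → proj₁ (reduce gy) (proj₂ hz) ≡ 0ℤ) gs
    reducedPairs [] [] [] = []
    reducedPairs ((g , y) ∷ gs) (_ ∷ f≡0) (g≡0 ∷ tri) =
      All.zipWith (λ {hz} (fz≡0 , gz≡0) →
        trans (reducedAt {g} fz≡0)
              (trans (cong (f p ℤ.*_) gz≡0) (ℤ.*-zeroʳ (f p)))) (f≡0 , g≡0)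
      ∷ reducedPairs gs f≡0 tri

  -- Each point of `P` costs at most one function and adds one vanishing condition to `V`. When `P`
  -- is exhausted, every function in `V` is zero, so none with a nonzero diagonal value is left.
  triangular-length : ∀ {V} → SubtractionClosed V → ∀ P →
    (∀ {f} → V f → All (λ p → f p ≡ 0ℤ) P → ∀ x → f x ≡ 0ℤ) →
    ∀ fs → Triangular V fs → length fs ≤ length P
  triangular-length V- [] determined [] _ = z≤n
  triangular-length V- [] determined ((f , x) ∷ fs) ((vf , fx≢0) ∷ _ , _) =
    contradiction (determined vf [] x) fx≢0
  triangular-length V- (p ∷ P) determined fs tri =
    let (gs , tri′ , len , _) = eliminate V- p fs tri
    in ≤-trans len (s≤s (triangular-length
         (λ {f} {g} a b (vf , fp≡0) (vg , gp≡0) → V- a b vf vg ,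
            trans (cong₂ (λ u v → a ℤ.* u ℤ.- b ℤ.* v) fp≡0 gp≡0) (zeros a b))
         P (λ (vf , fp≡0) fP≡0 → determined vf (fp≡0 ∷ fP≡0)) gs tri′))
    where
    zeros : ∀ a b → a ℤ.* 0ℤ ℤ.- b ℤ.* 0ℤ ≡ 0ℤ
    zeros = ℤ-Ring.solve-∀

-- Product polynomials and the first bound

-- The product of |A ∩ x| + c - l over l ∈ L. The summand `c` is the contribution of the fixed
-- point: 1 if the full set contains it, 0 if not.
productPoly : ∀ {n} → Subset n → ℤ → List ℕ → Subset n → ℤ
productPoly A c [] x = 1ℤ
productPoly A c (l ∷ L) x = productPoly A c L x ℤ.* ((pos ∣ A ∩ x ∣) ℤ.+ (c ℤ.- pos l))

productPoly-degree : ∀ {n} (A : Subset n) c L → Degree< (suc (length L)) (productPoly A c L)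
productPoly-degree A c [] = degree<-const 1ℤ
productPoly-degree A c (l ∷ L) =
  degree<-* (suc (length L)) A (c ℤ.- pos l) (productPoly-degree A c L) (λ _ → refl)

productPoly-zero : ∀ {n} (A : Subset n) c L x {l} → l ∈ L → (pos ∣ A ∩ x ∣) ℤ.+ c ≡ pos l →
                   productPoly A c L x ≡ 0ℤ
productPoly-zero A c (l ∷ L) x (here refl) e =
  trans (cong (productPoly A c L x ℤ.*_) (trans (sym (ℤ.+-assoc (pos ∣ A ∩ x ∣) c (ℤ.- pos l)))
          (ℤ.i≡j⇒i-j≡0 e)))
        (ℤ.*-zeroʳ (productPoly A c L x))
productPoly-zero A c (l ∷ L) x (there l∈L) e =
  cong (ℤ._* ((pos ∣ A ∩ x ∣) ℤ.+ (c ℤ.- pos l))) (productPoly-zero A c L x l∈L e)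

productPoly-nonzero : ∀ {n} (A : Subset n) c L x → All (λ l → (pos ∣ A ∩ x ∣) ℤ.+ c ≢ pos l) L →
                      productPoly A c L x ≢ 0ℤ
productPoly-nonzero A c [] x [] ()
productPoly-nonzero A c (l ∷ L) x (≢l ∷ ≢L) e =
  [ productPoly-nonzero A c L x ≢L
  , (λ e′ → ≢l (ℤ.i-j≡0⇒i≡j _ _ (trans (ℤ.+-assoc (pos ∣ A ∩ x ∣) c (ℤ.- pos l)) e′)))
  ]′ (ℤ.i*j≡0⇒i≡0∨j≡0 (productPoly A c L x) e)

length-filter-∁ : ∀ {X : Set} {P : X → Set} (P? : Decidable P) xs →
                  length xs ≡ length (filter P? xs) + length (filter (¬? ∘ P?) xs)
length-filter-∁ P? [] = refl
length-filter-∁ P? (x ∷ xs) with P? x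
... | yes _ = cong suc (length-filter-∁ P? xs)
... | no _ = trans (cong suc (length-filter-∁ P? xs)) (sym (+-suc _ _))

AllPairs-lookup : ∀ {X : Set} {R : X → X → Set} → Symmetric R → ∀ {xs} → AllPairs R xs →
                  ∀ {x y} → x ∈ xs → y ∈ xs → x ≢ y → R x y
AllPairs-lookup R-sym (Rx ∷ Rxs) (here refl) (here refl) x≢y = contradiction refl x≢y
AllPairs-lookup R-sym (Rx ∷ Rxs) (here refl) (there y∈xs) x≢y = All.lookup Rx y∈xs
AllPairs-lookup R-sym (Rx ∷ Rxs) (there x∈xs) (here refl) x≢y = R-sym (All.lookup Rx x∈xs)
AllPairs-lookup R-sym (Rx ∷ Rxs) (there x∈xs) (there y∈xs) x≢y = AllPairs-lookup R-sym Rxs x∈xs y∈xs x≢y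

AllPairs-restrict : ∀ {X : Set} {P : X → Set} {R : X → X → Set} {xs} → All P xs → AllPairs R xs →
                    AllPairs (λ x y → P x × P y × R x y) xs
AllPairs-restrict [] [] = []
AllPairs-restrict (px ∷ pxs) (Rx ∷ Rxs) =
  All.zipWith (λ (py , r) → px , py , r) (pxs , Rx) ∷ AllPairs-restrict pxs Rxs

-- |A ∩ B| < |A| encodes A ⊈ B.
SpernerPair : ∀ {n} → (ℕ → Set) → Subset n → Subset n → Set
SpernerPair K A B = K ∣ A ∩ B ∣ × ∣ A ∩ B ∣ < ∣ A ∣ × ∣ A ∩ B ∣ < ∣ B ∣

SpernerPair-sym : ∀ {n} K → Symmetric (SpernerPair {n} K)
SpernerPair-sym K {x = A} {B} (k , <A , <B) rewrite ∩-comm A B = k , <B , <A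

polynomialBound : ∀ {n} L (F : List (Subset (suc n))) → AllPairs (SpernerPair (_∈ L)) F →
                  length F ≤ binomSum n (suc (length L))
polynomialBound {n} L F sperner = begin
  length F                              ≡⟨ length-filter-∁ out? F ⟩
  length (filter out? F) + length (filter (¬? ∘ out?) F)
                                        ≡⟨ length-++ (filter out? F) ⟨
  length ordered                        ≡⟨ length-map _ ordered ⟨
  length (map polyPoint ordered)        ≤⟨ triangular-length subClosed (smallSets n d)
                                             (degree<-vanishing d) (map polyPoint ordered)
                                             (All.map⁺ (All.universal diagonal ordered) ,
                                              AllPairs.map⁺ orderedPairs) ⟩
  length (smallSets n d)                ≡⟨ length-smallSets n d ⟩
  binomSum n d                          ∎
  where
  open ≤-Reasoning
  d = suc (length L)

  out? : Decidable (λ (A : Subset (suc n)) → head A ≡ outside)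
  out? A = head A Bool.≟ outside

  -- Sets avoiding the first element come first: f_A does not see that element when A avoids it.
  ordered = filter out? F ++ filter (¬? ∘ out?) F

  weight : Bool → ℤ
  weight outside = 0ℤ
  weight inside = 1ℤ

  -- Keeping only l < |A| makes the value at A itself nonzero, while the Sperner condition puts
  -- every |A ∩ B| among the kept values.
  poly : Subset (suc n) → Subset n → ℤ
  poly (a ∷ A) = productPoly A (weight a) (filter (_<? ∣ a ∷ A ∣) L)

  polyPoint : Subset (suc n) → (Subset n → ℤ) × Subset n
  polyPoint A = poly A , tail A

  subClosed : SubtractionClosed (Degree< {n} d)
  subClosed {f} {g} a b df dg =
    degree<-linear d a (ℤ.- b) df dg
      (λ x → cong (λ z → a ℤ.* f x ℤ.+ z) (ℤ.neg-distribˡ-* b (g x)))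

  raise : ∀ {s t} {f : Subset n → ℤ} → s ≤′ t → Degree< s f → Degree< t f
  raise ≤′-refl df = df
  raise (≤′-step s≤t) df = degree<-suc _ (raise s≤t df)

  weight-∩-inside : ∀ a (A x : Subset n) → (pos ∣ A ∩ x ∣) ℤ.+ weight a ≡ (pos ∣ (a ∷ A) ∩ (inside ∷ x) ∣)
  weight-∩-inside inside A x = cong pos (+-comm _ 1)
  weight-∩-inside outside A x = ℤ.+-identityʳ _

  weight-∩-self : ∀ a (A : Subset n) → (pos ∣ A ∩ A ∣) ℤ.+ weight a ≡ (pos ∣ a ∷ A ∣)
  weight-∩-self a A rewrite ∩-idem A with a
  ... | inside = cong pos (+-comm _ 1)
  ... | outside = ℤ.+-identityʳ _

  diagonal : ∀ A → Degree< d (poly A) × poly A (tail A) ≢ 0ℤ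
  diagonal (a ∷ A) =
    raise (≤⇒≤′ (s≤s (length-filter (_<? ∣ a ∷ A ∣) L)))
      (productPoly-degree A (weight a) (filter (_<? ∣ a ∷ A ∣) L)) ,
    productPoly-nonzero A (weight a) (filter (_<? ∣ a ∷ A ∣) L) A
      (All.map (λ l<∣A∣ e → <⇒≢ l<∣A∣ (sym (ℤ.+-injective (trans (sym (weight-∩-self a A)) e))))
        (All.all-filter (_<? ∣ a ∷ A ∣) L))

  -- The value at `tail B` is that of f_A at B with the first element added. This addition leaves
  -- the intersection with A unchanged if A avoids the element or B already has it.
  vanishes : ∀ A B → SpernerPair (_∈ L) A B → (head A ≡ outside) ⊎ (head B ≡ inside) → poly A (tail B) ≡ 0ℤ
  vanishes (a ∷ A) (b ∷ B) (∈L , <A , _) h =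
    productPoly-zero A (weight a) _ B (∈-filter⁺ (_<? ∣ a ∷ A ∣) ∈L <A) (value a b h)
    where
    value : ∀ a b → (a ≡ outside) ⊎ (b ≡ inside) → (pos ∣ A ∩ B ∣) ℤ.+ weight a ≡ (pos ∣ (a ∷ A) ∩ (b ∷ B) ∣)
    value a _ (inj₂ refl) = weight-∩-inside a A B
    value _ b (inj₁ refl) = ℤ.+-identityʳ _

  notOut : ∀ {b} → b ≢ outside → b ≡ inside
  notOut {inside} _ = refl
  notOut {outside} b≢out = contradiction refl b≢out

  orderedPairs : AllPairs (λ A B → poly A (tail B) ≡ 0ℤ) ordered
  orderedPairs = AllPairs.++⁺
    (AllPairs.map (λ {A} {B} (outA , _ , r) → vanishes A B r (inj₁ outA))
      (AllPairs-restrict (All.all-filter out? F) (AllPairs.filter⁺ out? sperner)))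
    (AllPairs.map (λ {A} {B} (_ , inB , r) → vanishes A B r (inj₂ (notOut inB)))
      (AllPairs-restrict (All.all-filter (¬? ∘ out?) F) (AllPairs.filter⁺ (¬? ∘ out?) sperner)))
    -- Members from different halves may occur in `F` in either order, hence the appeal to symmetry;
    -- they are distinct because their heads differ.
    (All.tabulate λ {A} A∈ → All.tabulate λ {B} B∈ →
      let (A∈F , outA) = ∈-filter⁻ out? A∈
          (B∈F , inB) = ∈-filter⁻ (¬? ∘ out?) {xs = F} B∈
      in vanishes A B (AllPairs-lookup (λ {A} {B} → SpernerPair-sym (_∈ L) {A} {B}) sperner A∈F B∈F (λ { refl → inB outA })) (inj₁ outA))

-- Links of points and double counting

contains? : ∀ {n} (j : Fin n) → Decidable (λ (A : Subset n) → lookup A j ≡ inside)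
contains? j A = lookup A j Bool.≟ inside

link : ∀ {n} → Fin (suc n) → List (Subset (suc n)) → List (Subset n)
link j F = map (λ A → removeAt A j) (filter (contains? j) F)

∣removeAt∣ : ∀ {n} (A : Subset (suc n)) j → lookup A j ≡ inside → ∣ A ∣ ≡ suc ∣ removeAt A j ∣
∣removeAt∣ (_ ∷ A) zero refl = refl
∣removeAt∣ (outside ∷ A@(_ ∷ _)) (suc j) j∈A = ∣removeAt∣ A j j∈A
∣removeAt∣ (inside ∷ A@(_ ∷ _)) (suc j) j∈A = cong suc (∣removeAt∣ A j j∈A)

removeAt-∩ : ∀ {n} (A B : Subset (suc n)) j → removeAt (A ∩ B) j ≡ removeAt A j ∩ removeAt B j
removeAt-∩ (_ ∷ A) (_ ∷ B) zero = refl
removeAt-∩ (_ ∷ A@(_ ∷ _)) (_ ∷ B@(_ ∷ _)) (suc j) = cong (_ ∷_) (removeAt-∩ A B j)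

∣removeAt-∩∣ : ∀ {n} (A B : Subset (suc n)) j → lookup A j ≡ inside → lookup B j ≡ inside →
               ∣ A ∩ B ∣ ≡ suc ∣ removeAt A j ∩ removeAt B j ∣
∣removeAt-∩∣ A B j j∈A j∈B = trans
  (∣removeAt∣ (A ∩ B) j (trans (lookup-zipWith _ j A B) (cong₂ _∧_ j∈A j∈B)))
  (cong (suc ∘ ∣_∣) (removeAt-∩ A B j))

-- Removing a common point lowers |A|, |B| and |A ∩ B| by one each, so the strict inequalities
-- survive and only the admissible intersection sizes shift.
link-sperner : ∀ {n K K′} → (∀ {k} → K (suc k) → K′ k) → ∀ j (F : List (Subset (suc n))) →
               AllPairs (SpernerPair K) F → AllPairs (SpernerPair K′) (link j F)
link-sperner {K = K} {K′} shift j F sperner = AllPairs.map⁺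
  (AllPairs.map (λ {A} {B} (j∈A , j∈B , pair) → descend A B j∈A j∈B pair)
    (AllPairs-restrict (All.all-filter (contains? j) F) (AllPairs.filter⁺ (contains? j) sperner)))
  where
  descend : ∀ A B → lookup A j ≡ inside → lookup B j ≡ inside → SpernerPair K A B →
            SpernerPair K′ (removeAt A j) (removeAt B j)
  descend A B j∈A j∈B (k , <A , <B)
    rewrite ∣removeAt-∩∣ A B j j∈A j∈B | ∣removeAt∣ A j j∈A | ∣removeAt∣ B j j∈B =
    shift k , s≤s⁻¹ <A , s≤s⁻¹ <B

∑-lookup : ∀ {n} (A : Subset n) c → ∑ (λ j → if lookup A j then c else 0) ≡ ∣ A ∣ * c
∑-lookup [] c = refl
∑-lookup (outside ∷ A) c = ∑-lookup A c
∑-lookup (inside ∷ A) c = cong (c +_) (∑-lookup A c)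

-- Counts incidences of points and members in two ways. The weight `g` is a chain weight in the LYM
-- induction and constantly 1 for the large members.
doubleCount : ∀ {n} (g : Subset n → ℕ) F →
              sum (map (λ A → ∣ A ∣ * g A) F) ≡ ∑ (λ j → sum (map g (filter (contains? j) F)))
doubleCount {n} g [] = sym (sum-replicate-zero n)
doubleCount {n} g (A ∷ F) = begin
  ∣ A ∣ * g A + sum (map (λ A → ∣ A ∣ * g A) F)
    ≡⟨ cong₂ _+_ (sym (∑-lookup A (g A))) (doubleCount g F) ⟩
  ∑ (λ j → if lookup A j then g A else 0) + ∑ (λ j → sum (map g (filter (contains? j) F)))
    ≡⟨ ∑-distrib-+ {n} _ _ ⟨
  ∑ (λ j → (if lookup A j then g A else 0) + sum (map g (filter (contains? j) F)))
    ≡⟨ sum-cong-≗ split ⟩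
  ∑ (λ j → sum (map g (filter (contains? j) (A ∷ F)))) ∎
  where
  open ≡-Reasoning
  split : ∀ j → (if lookup A j then g A else 0) + sum (map g (filter (contains? j) F))
                ≡ sum (map g (filter (contains? j) (A ∷ F)))
  split j with lookup A j
  ... | inside = refl
  ... | outside = refl

∑-≤ : ∀ {n} {f : Fin n → ℕ} {U} → (∀ j → f j ≤ U) → ∑ f ≤ n * U
∑-≤ {zero} f≤U = z≤n
∑-≤ {suc n} f≤U = +-mono-≤ (f≤U zero) (∑-≤ (f≤U ∘ suc))

-- The LYM inequality for intersections smaller than s

-- The number of maximal chains of subsets of [n] assigned to a k-set A by the
-- LYM argument: those through A if k ≤ s, those whose s-th member lies in A if
-- k ≥ s. The recursion is over the first element added to the chain; the value 0
-- is junk, as no k-set with k > n exists.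
chainWeight : ℕ → ℕ → ℕ → ℕ
chainWeight n zero k = n !
chainWeight n (suc s) zero = n !
chainWeight zero (suc s) (suc k) = 0
chainWeight (suc n) (suc s) (suc k) = suc k * chainWeight n s k

chainWeight-≤ : ∀ n s k → k ≤ n → chainWeight n s k ≤ n !
chainWeight-≤ n zero k k≤n = ≤-refl
chainWeight-≤ n (suc s) zero k≤n = ≤-refl
chainWeight-≤ (suc n) (suc s) (suc k) (s≤s k≤n) = *-mono-≤ (s≤s k≤n) (chainWeight-≤ n s k k≤n)

-- Disjointness of the claimed chains is proved by induction on their first element `j`: the claimed
-- chains starting with `j` correspond to those claimed in the link of `j`, with `s` lowered by one.
-- Families with at most one member are separate, since the recursion for the weight fails at the
-- empty set.
chainWeight-sum : ∀ s {n} (F : List (Subset n)) → AllPairs (SpernerPair (_< s)) F →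
                  sum (map (chainWeight n s ∘ ∣_∣) F) ≤ n !
chainWeight-sum s [] _ = z≤n
chainWeight-sum s {n} (A ∷ []) _ =
  ≤-trans (≤-reflexive (+-identityʳ _)) (chainWeight-≤ n s ∣ A ∣ (∣p∣≤n A))
chainWeight-sum zero (A ∷ B ∷ F) (((() , _) ∷ _) ∷ _)
chainWeight-sum (suc s) {zero} ([] ∷ B ∷ F) (((_ , () , _) ∷ _) ∷ _)
chainWeight-sum (suc s) {suc n} F@(A ∷ B ∷ _) sperner@((AB ∷ AF) ∷ _) = begin
  sum (map (chainWeight (suc n) (suc s) ∘ ∣_∣) F)
    ≡⟨ cong sum (map-cong-local (All.map (λ {A} → unfold ∣ A ∣) nonempty)) ⟩
  sum (map (λ A → ∣ A ∣ * chainWeight n s (∣ A ∣ ∸ 1)) F)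
    ≡⟨ doubleCount (λ A → chainWeight n s (∣ A ∣ ∸ 1)) F ⟩
  ∑ (λ j → sum (map (λ A → chainWeight n s (∣ A ∣ ∸ 1)) (filter (contains? j) F)))
    ≤⟨ ∑-≤ linkBound ⟩
  suc n * n ! ∎
  where
  open ≤-Reasoning
  unfold : ∀ k → 1 ≤ k → chainWeight (suc n) (suc s) k ≡ k * chainWeight n s (k ∸ 1)
  unfold (suc k) _ = refl

  -- With two or more members, each set has an intersection strictly smaller than itself and so is
  -- not empty.
  nonempty : All (λ A → 1 ≤ ∣ A ∣) F
  nonempty = ≤-trans (s≤s z≤n) (proj₁ (proj₂ AB)) ∷
             All.map (λ (_ , _ , <B) → ≤-trans (s≤s z≤n) <B) (AB ∷ AF)

  linkBound : ∀ j → sum (map (λ A → chainWeight n s (∣ A ∣ ∸ 1)) (filter (contains? j) F)) ≤ n !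
  linkBound j = begin
    sum (map (λ A → chainWeight n s (∣ A ∣ ∸ 1)) (filter (contains? j) F))
      ≡⟨ cong sum (map-cong-local (All.map (λ {A} j∈A → cong (λ k → chainWeight n s (k ∸ 1)) (∣removeAt∣ A j j∈A))
           (All.all-filter (contains? j) F))) ⟩
    sum (map (λ A → chainWeight n s ∣ removeAt A j ∣) (filter (contains? j) F))
      ≡⟨ cong sum (map-∘ (filter (contains? j) F)) ⟩
    sum (map (chainWeight n s ∘ ∣_∣) (link j F))
      ≤⟨ chainWeight-sum s (link j F) (link-sperner {K = _< suc s} s≤s⁻¹ j F sperner) ⟩
    n ! ∎

chainWeight-small : ∀ n s k → k ≤ s → s ≤ n → chainWeight n s k ≡ k ! * (n ∸ k) !
chainWeight-small n zero zero _ _ = sym (+-identityʳ (n !))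
chainWeight-small n (suc s) zero _ _ = sym (+-identityʳ (n !))
chainWeight-small (suc n) (suc s) (suc k) (s≤s k≤s) (s≤s s≤n) =
  trans (cong (suc k *_) (chainWeight-small n s k k≤s s≤n)) (sym (*-assoc (suc k) (k !) ((n ∸ k) !)))

chainWeight-large : ∀ n s k → s ≤ k → k ≤ n → s ! * (n ∸ s) ! ≤ chainWeight n s k
chainWeight-large n zero k _ _ = ≤-reflexive (+-identityʳ (n !))
chainWeight-large (suc n) (suc s) (suc k) (s≤s s≤k) (s≤s k≤n) =
  ≤-trans (≤-reflexive (*-assoc (suc s) (s !) ((n ∸ s) !)))
          (*-mono-≤ (s≤s s≤k) (chainWeight-large n s k s≤k k≤n))

-- Strictness comes from the first factor, `k` against `s`; for s = 0 all weights would equal `n !`.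
chainWeight-larger : ∀ n s k → 1 ≤ s → s < k → k ≤ n → s ! * (n ∸ s) ! < chainWeight n s k
chainWeight-larger (suc n) (suc s) (suc k) _ (s≤s s<k) (s≤s k≤n) = begin-strict
  (suc s * s !) * (n ∸ s) !  ≡⟨ *-assoc (suc s) (s !) ((n ∸ s) !) ⟩
  suc s * (s ! * (n ∸ s) !)  <⟨ *-monoˡ-< (s ! * (n ∸ s) !) {{s !* (n ∸ s) !≢0}} (s≤s s<k) ⟩
  suc k * (s ! * (n ∸ s) !)  ≤⟨ *-monoʳ-≤ (suc k) (chainWeight-large n s k (<⇒≤ s<k) k≤n) ⟩
  suc k * chainWeight n s k  ∎
  where open ≤-Reasoning

-- This is C(n, k) < C(n, s) in factorial form, with s = k + d + 1 and n = s + m. Raising `d` by one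
-- multiplies the left side by k + d + 1 and the right side by the larger m + d + 1.
!*!-shift : ∀ k m d → k < m → (k + suc d) ! * m ! < k ! * (m + suc d) !
!*!-shift k m d k<m = begin-strict
  (k + suc d) ! * m !              ≡⟨ cong (λ z → z ! * m !) (+-suc k d) ⟩
  (suc (k + d) * (k + d) !) * m !  ≡⟨ *-assoc (suc (k + d)) ((k + d) !) (m !) ⟩
  suc (k + d) * ((k + d) ! * m !)  <⟨ *-monoˡ-< ((k + d) ! * m !) {{(k + d) !* m !≢0}} (s≤s (+-monoˡ-< d k<m)) ⟩
  suc (m + d) * ((k + d) ! * m !)  ≤⟨ *-monoʳ-≤ (suc (m + d)) (weak d) ⟩
  suc (m + d) * (k ! * (m + d) !)  ≡⟨ exchange (suc (m + d)) (k !) ((m + d) !) ⟩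
  k ! * (suc (m + d) * (m + d) !)  ≡⟨ cong (λ z → k ! * z !) (+-suc m d) ⟨
  k ! * (m + suc d) !              ∎
  where
  open ≤-Reasoning
  exchange : ∀ a b c → a * (b * c) ≡ b * (a * c)
  exchange = ℕ-Ring.solve-∀
  weak : ∀ d → (k + d) ! * m ! ≤ k ! * (m + d) !
  weak zero = ≤-reflexive (cong₂ (λ a b → a ! * b !) (+-identityʳ k) (sym (+-identityʳ m)))
  weak (suc d) = <⇒≤ (!*!-shift k m d k<m)

chainWeight-smaller : ∀ n s k → k < s → s + s ≤ n → s ! * (n ∸ s) ! < chainWeight n s k
chainWeight-smaller n s k k<s 2s≤n with m≤n⇒∃[o]m+o≡n k<s | m≤n⇒∃[o]m+o≡n (m+n≤o⇒m≤o s 2s≤n)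
... | d , refl | m , refl = subst (suc (k + d) ! * (suc (k + d) + m ∸ suc (k + d)) ! <_)
        (sym (chainWeight-small n s k (<⇒≤ k<s) (m≤m+n s m))) (begin-strict
  s ! * (s + m ∸ s) !        ≡⟨ cong (λ z → s ! * z !) (m+n∸m≡n s m) ⟩
  s ! * m !                  ≡⟨ cong (λ z → z ! * m !) (+-suc k d) ⟨
  (k + suc d) ! * m !        <⟨ !*!-shift k m d (<-≤-trans k<s (+-cancelˡ-≤ s s m 2s≤n)) ⟩
  k ! * (m + suc d) !        ≡⟨ cong (λ z → k ! * z !) complement ⟨
  k ! * (n ∸ k) !            ∎)
  where
  open ≤-Reasoning
  rearrange : ∀ k d m → suc (k + d) + m ≡ k + (m + suc d)
  rearrange = ℕ-Ring.solve-∀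
  complement : n ∸ k ≡ m + suc d
  complement = trans (cong (_∸ k) (rearrange k d m)) (m+n∸m≡n k (m + suc d))

chainWeight-minimal : ∀ n s k → 1 ≤ s → s + s ≤ n → k ≤ n → k ≢ s → s ! * (n ∸ s) ! < chainWeight n s k
chainWeight-minimal n s k 1≤s 2s≤n k≤n k≢s with <-cmp k s
... | tri< k<s _ _ = chainWeight-smaller n s k k<s 2s≤n
... | tri≈ _ k≡s _ = contradiction k≡s k≢s
... | tri> _ _ s<k = chainWeight-larger n s k 1≤s s<k k≤n

length*≤sum : ∀ {X : Set} (f : X → ℕ) u xs → All (λ x → u ≤ f x) xs → length xs * u ≤ sum (map f xs)
length*≤sum f u [] [] = z≤n
length*≤sum f u (x ∷ xs) (u≤ ∷ us≤) = +-mono-≤ u≤ (length*≤sum f u xs us≤)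

length*<sum : ∀ {X : Set} (f : X → ℕ) u xs → All (λ x → u ≤ f x) xs → ∀ {x} → x ∈ xs → u < f x →
              length xs * u < sum (map f xs)
length*<sum f u (x ∷ xs) (_ ∷ us≤) (here refl) u< = +-mono-<-≤ u< (length*≤sum f u xs us≤)
length*<sum f u (x ∷ xs) (u≤ ∷ us≤) (there x∈) u< = +-mono-≤-< u≤ (length*<sum f u xs us≤ x∈ u<)

nCk*k![n∸k]!≡n! : ∀ {n k} → k ≤ n → (n C k) * (k ! * (n ∸ k) !) ≡ n !
nCk*k![n∸k]!≡n! {n} {k} k≤n =
  trans (cong (_* (k ! * (n ∸ k) !)) (nCk≡n!/k![n-k]! k≤n)) (m/n*n≡m (k![n∸k]!∣n! k≤n))
  where instance _ = k !* (n ∸ k) !≢0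

module _ {n s} (1≤s : 1 ≤ s) (2s≤n : s + s ≤ n) (F : List (Subset n))
         (sperner : AllPairs (SpernerPair (_< s)) F) where

  private
    s≤n = m+n≤o⇒m≤o s 2s≤n
    u = s ! * (n ∸ s) !

    instance _ = s !* (n ∸ s) !≢0

    u≤weight : ∀ (A : Subset n) → u ≤ chainWeight n s ∣ A ∣
    u≤weight A with ∣ A ∣ ℕ.≟ s
    ... | yes ∣A∣≡s = ≤-reflexive (sym (trans (cong (chainWeight n s) ∣A∣≡s) (chainWeight-small n s s ≤-refl s≤n)))
    ... | no ∣A∣≢s = <⇒≤ (chainWeight-minimal n s ∣ A ∣ 1≤s 2s≤n (∣p∣≤n A) ∣A∣≢s)

    total : sum (map (chainWeight n s ∘ ∣_∣) F) ≤ (n C s) * u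
    total = ≤-trans (chainWeight-sum s F sperner) (≤-reflexive (sym (nCk*k![n∸k]!≡n! s≤n)))

  lymBound : length F ≤ n C s
  lymBound = *-cancelʳ-≤ (length F) (n C s) u
    (≤-trans (length*≤sum (chainWeight n s ∘ ∣_∣) u F (All.universal u≤weight F)) total)

  lymBound-uniform : length F ≡ n C s → ∀ {A} → A ∈ F → ∣ A ∣ ≡ s
  lymBound-uniform tight {A} A∈F with ∣ A ∣ ℕ.≟ s
  ... | yes ∣A∣≡s = ∣A∣≡s
  ... | no ∣A∣≢s = contradiction tight (<⇒≢ (*-cancelʳ-< u (length F) (n C s)
    (<-≤-trans (length*<sum (chainWeight n s ∘ ∣_∣) u F (All.universal u≤weight F) A∈F
                 (chainWeight-minimal n s ∣ A ∣ 1≤s 2s≤n (∣p∣≤n A) ∣A∣≢s)) total)))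

-- The case of equality in the LYM bound

∣A∩B∣≡∣A∣⇒A⊆B : ∀ {n} (A B : Subset n) → ∣ A ∩ B ∣ ≡ ∣ A ∣ → A ⊆ B
∣A∩B∣≡∣A∣⇒A⊆B [] [] _ ()
∣A∩B∣≡∣A∣⇒A⊆B (outside ∷ A) (b ∷ B) e = out⊆ (∣A∩B∣≡∣A∣⇒A⊆B A B e)
∣A∩B∣≡∣A∣⇒A⊆B (inside ∷ A) (inside ∷ B) e = in⊆in (∣A∩B∣≡∣A∣⇒A⊆B A B (suc-injective e))
∣A∩B∣≡∣A∣⇒A⊆B (inside ∷ A) (outside ∷ B) e = contradiction e (<⇒≢ (s≤s (∣p∩q∣≤∣p∣ A B)))

⊈⇒∣∩∣< : ∀ {n} (A B : Subset n) → ¬ (A ⊆ B) → ∣ A ∩ B ∣ < ∣ A ∣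
⊈⇒∣∩∣< A B A⊈B = ≤∧≢⇒< (∣p∩q∣≤∣p∣ A B) (A⊈B ∘ ∣A∩B∣≡∣A∣⇒A⊆B A B)

uniform-∩ : ∀ {n} (A B : Subset n) → ∣ A ∣ ≡ ∣ B ∣ → A ≢ B → ∣ A ∩ B ∣ < ∣ A ∣
uniform-∩ A B ∣A∣≡∣B∣ A≢B = ≤∧≢⇒< (∣p∩q∣≤∣p∣ A B) λ e →
  A≢B (⊆-antisym (∣A∩B∣≡∣A∣⇒A⊆B A B e)
                 (∣A∩B∣≡∣A∣⇒A⊆B B A (trans (cong ∣_∣ (∩-comm B A)) (trans e ∣A∣≡∣B∣))))

-- When the bound is attained, all members are s-sets, so a missing s-set could be added with all
-- intersections still smaller than `s`, and the larger family would break the bound. Decidable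
-- membership removes the double negation where this is used.
lymBound-full : ∀ {n s} → 1 ≤ s → s + s ≤ n → (F : List (Subset n)) → AllPairs (SpernerPair (_< s)) F →
                length F ≡ n C s → ∀ A → ∣ A ∣ ≡ s → ¬ (A ∉ F)
lymBound-full {n} {s} 1≤s 2s≤n F sperner tight A ∣A∣≡s A∉F =
  <⇒≱ (≤-reflexive (cong suc (sym tight))) (lymBound 1≤s 2s≤n (A ∷ F) (All.tabulate pair ∷ sperner))
  where
  pair : ∀ {B} → B ∈ F → SpernerPair (_< s) A B
  pair {B} B∈F = subst (∣ A ∩ B ∣ <_) ∣A∣≡s <A , <A , subst (∣ A ∩ B ∣ <_) ∣A∣≡∣B∣ <A
    where
    ∣A∣≡∣B∣ : ∣ A ∣ ≡ ∣ B ∣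
    ∣A∣≡∣B∣ = trans ∣A∣≡s (sym (lymBound-uniform 1≤s 2s≤n F sperner tight B∈F))
    <A = uniform-∩ A B ∣A∣≡∣B∣ λ { refl → A∉F B∈F }

Unique-⊆-length : ∀ {X : Set} {xs ys : List X} → Unique xs → (∀ {x} → x ∈ xs → x ∈ ys) →
                  length xs ≤ length ys
Unique-⊆-length {xs = []} [] _ = z≤n
Unique-⊆-length {xs = x ∷ xs} (x∉xs ∷ unique) xs⊆ys with ∈-∃++ (xs⊆ys (here refl))
... | as , bs , refl = begin
  suc (length xs)              ≤⟨ s≤s (Unique-⊆-length unique avoid) ⟩
  suc (length (as ++ bs))      ≡⟨ cong suc (length-++ as) ⟩
  suc (length as + length bs)  ≡⟨ +-suc (length as) (length bs) ⟨
  length as + suc (length bs)  ≡⟨ length-++ as ⟨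
  length (as ++ x ∷ bs)        ∎
  where
  open ≤-Reasoning
  avoid : ∀ {y} → y ∈ xs → y ∈ as ++ bs
  avoid y∈xs with ∈-++⁻ as (xs⊆ys (there y∈xs))
  ... | inj₁ y∈as = ∈-++⁺ˡ y∈as
  ... | inj₂ (here refl) = contradiction refl (All.lookup x∉xs y∈xs)
  ... | inj₂ (there y∈bs) = ∈-++⁺ʳ as y∈bs

uniformSets : ∀ n → ℕ → List (Subset n)
uniformSets n zero = ⊥ ∷ []
uniformSets zero (suc s) = []
uniformSets (suc n) (suc s) = map (outside ∷_) (uniformSets n (suc s)) ++ map (inside ∷_) (uniformSets n s)

uniformSets-size : ∀ n s → All (λ A → ∣ A ∣ ≡ s) (uniformSets n s)
uniformSets-size n zero = ∣⊥∣≡0 n ∷ []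
uniformSets-size zero (suc s) = []
uniformSets-size (suc n) (suc s) = All.++⁺
  (All.map⁺ (uniformSets-size n (suc s)))
  (All.map⁺ (All.map (cong suc) (uniformSets-size n s)))

length-uniformSets : ∀ n s → length (uniformSets n s) ≡ n C s
length-uniformSets n zero = refl
length-uniformSets zero (suc s) = refl
length-uniformSets (suc n) (suc s) = begin
  length (map (outside ∷_) (uniformSets n (suc s)) ++ map (inside ∷_) (uniformSets n s))
    ≡⟨ length-++ (map (outside ∷_) (uniformSets n (suc s))) ⟩
  length (map (outside ∷_) (uniformSets n (suc s))) + length (map (inside ∷_) (uniformSets n s))
    ≡⟨ cong₂ _+_ (trans (length-map _ (uniformSets n (suc s))) (length-uniformSets n (suc s)))
                 (trans (length-map _ (uniformSets n s)) (length-uniformSets n s)) ⟩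
  n C suc s + n C s
    ≡⟨ +-comm (n C suc s) (n C s) ⟩
  n C s + n C suc s
    ≡⟨ nCk+nC[k+1]≡[n+1]C[k+1] n s ⟩
  suc n C suc s ∎
  where open ≡-Reasoning

uniformSets-unique : ∀ n s → Unique (uniformSets n s)
uniformSets-unique n zero = [] ∷ []
uniformSets-unique zero (suc s) = []
uniformSets-unique (suc n) (suc s) = Unique.++⁺
  (Unique.map⁺ ∷-injectiveʳ (uniformSets-unique n (suc s)))
  (Unique.map⁺ ∷-injectiveʳ (uniformSets-unique n s))
  disjoint
  where
  disjoint : ∀ {A} → ¬ (A ∈ map (outside ∷_) (uniformSets n (suc s)) × A ∈ map (inside ∷_) (uniformSets n s))
  disjoint (o , i) with ∈-map⁻ (outside ∷_) o | ∈-map⁻ (inside ∷_) i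
  ... | _ , _ , refl | _ , _ , ()

-- Estimates for binomial coefficients

-- The rule (k+1) C(n, k+1) = (n-k) C(n, k), written without subtraction so that induction by
-- Pascal's rule needs no case k > n.
C-balance : ∀ n k → suc k * (n C suc k) + k * (n C k) ≡ n * (n C k)
C-balance zero zero = refl
C-balance zero (suc k) = cong₂ _+_ (*-zeroʳ (suc (suc k))) (*-zeroʳ (suc k))
C-balance (suc n) zero = begin
  1 * (suc n C 1) + 0  ≡⟨ +-identityʳ _ ⟩
  1 * (suc n C 1)      ≡⟨ *-identityˡ _ ⟩
  suc n C 1            ≡⟨ nC1≡n (suc n) ⟩
  suc n                ≡⟨ *-identityʳ (suc n) ⟨
  suc n * 1            ∎
  where open ≡-Reasoning
C-balance (suc n) (suc k) = begin
  (2 + k) * (suc n C (2 + k)) + suc k * (suc n C suc k)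
    ≡⟨ cong₂ (λ a b → (2 + k) * a + suc k * b) (nCk+nC[k+1]≡[n+1]C[k+1] n (suc k)) (nCk+nC[k+1]≡[n+1]C[k+1] n k) ⟨
  (2 + k) * (c₁ + c₂) + suc k * (c₀ + c₁)
    ≡⟨ regroup k c₀ c₁ c₂ ⟩
  ((2 + k) * c₂ + suc k * c₁) + (suc k * c₁ + k * c₀) + (c₀ + c₁)
    ≡⟨ cong₂ (λ a b → a + b + (c₀ + c₁)) (C-balance n (suc k)) (C-balance n k) ⟩
  n * c₁ + n * c₀ + (c₀ + c₁)
    ≡⟨ collect n c₀ c₁ ⟩
  suc n * (c₀ + c₁)
    ≡⟨ cong (suc n *_) (nCk+nC[k+1]≡[n+1]C[k+1] n k) ⟩
  suc n * (suc n C suc k) ∎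
  where
  open ≡-Reasoning
  c₀ = n C k
  c₁ = n C suc k
  c₂ = n C (2 + k)
  regroup : ∀ k a b c → (2 + k) * (b + c) + suc k * (a + b) ≡ ((2 + k) * c + suc k * b) + (suc k * b + k * a) + (a + b)
  regroup = ℕ-Ring.solve-∀
  collect : ∀ n a b → n * b + n * a + (a + b) ≡ suc n * (a + b)
  collect = ℕ-Ring.solve-∀

C-absorb : ∀ n k → suc k * (suc n C suc k) ≡ suc n * (n C k)
C-absorb n k = begin
  suc k * (suc n C suc k)                          ≡⟨ cong (suc k *_) (nCk+nC[k+1]≡[n+1]C[k+1] n k) ⟨
  suc k * (n C k + n C suc k)                      ≡⟨ regroup k (n C k) (n C suc k) ⟩
  n C k + (suc k * (n C suc k) + k * (n C k))      ≡⟨ cong (n C k +_) (C-balance n k) ⟩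
  suc n * (n C k)                                  ∎
  where
  open ≡-Reasoning
  regroup : ∀ k a b → suc k * (a + b) ≡ a + (suc k * b + k * a)
  regroup = ℕ-Ring.solve-∀

C-ratio : ∀ k m → suc k * ((k + m) C suc k) ≡ m * ((k + m) C k)
C-ratio k m = +-cancelʳ-≡ (k * ((k + m) C k)) _ _
  (trans (C-balance (k + m) k) (split k m ((k + m) C k)))
  where
  split : ∀ k m c → (k + m) * c ≡ m * c + k * c
  split = ℕ-Ring.solve-∀

-- The ratio of the two coefficients is (n-k)/(k+1), which is at least 2 as soon as n ≥ 3k + 2.
C-doubling : ∀ n k → 2 + 3 * k ≤ n → n C k + n C k ≤ n C suc k
C-doubling n k 2+3k≤n with m≤n⇒∃[o]m+o≡n (m+n≤o⇒m≤o k (subst (_≤ n) (split k) 2+3k≤n))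
  where
  split : ∀ k → 2 + 3 * k ≡ k + (2 * suc k)
  split = ℕ-Ring.solve-∀
... | m , refl = *-cancelˡ-≤ (suc k) (begin
  suc k * (c + c)                  ≡⟨ regroup k c ⟩
  (2 * suc k) * c                  ≤⟨ *-monoˡ-≤ c (+-cancelˡ-≤ k _ _ (subst (_≤ k + m) (split k) 2+3k≤n)) ⟩
  m * c                            ≡⟨ C-ratio k m ⟨
  suc k * ((k + m) C suc k)        ∎)
  where
  open ≤-Reasoning
  c = (k + m) C k
  split : ∀ k → 2 + 3 * k ≡ k + (2 * suc k)
  split = ℕ-Ring.solve-∀
  regroup : ∀ k c → suc k * (c + c) ≡ (2 * suc k) * c
  regroup = ℕ-Ring.solve-∀

-- In this range each coefficient is at least twice the one before, so it exceeds the sum of all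
-- earlier ones, as in a geometric series.
binomSum<C : ∀ n k → 3 * k ≤ suc n → binomSum n k < n C k
binomSum<C n zero _ = s≤s z≤n
binomSum<C n (suc k) 3[1+k]≤1+n = begin-strict
  binomSum n k + n C k  <⟨ +-monoˡ-< (n C k) (binomSum<C n k (≤-trans (m≤n+m (3 * k) 3) 3+3k≤1+n)) ⟩
  n C k + n C k         ≤⟨ C-doubling n k (s≤s⁻¹ 3+3k≤1+n) ⟩
  n C suc k             ∎
  where
  open ≤-Reasoning
  3+3k≤1+n : 3 + 3 * k ≤ suc n
  3+3k≤1+n = subst (_≤ suc n) (*-suc 3 k) 3[1+k]≤1+n

-- With N = u + m, the variables stand for b = C(N, u), b′ = C(N, u+1) and c = C(N+1, u+2). Then c/b
-- = (N+1)m/((u+1)(u+2)), while S + b ≤ 2b and N + 2 ≤ 2(N+1) lose a factor of 4 in total.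
two-step-ratio : ∀ u m {b b′ c S} → suc u * b′ ≡ m * b → (2 + u) * c ≡ suc (u + m) * b′ →
                 S ≤ b → 4 * (2 + u) ≤ m → (2 + (u + m)) * (S + b) ≤ suc u * c
two-step-ratio u m {b} {b′} {c} {S} ratio absorb S≤b 4[2+u]≤m = *-cancelˡ-≤ (2 + u) (begin
  (2 + u) * ((2 + (u + m)) * (S + b))
    ≤⟨ *-monoʳ-≤ (2 + u) (*-mono-≤ 2+N≤2[1+N] (+-monoˡ-≤ b S≤b)) ⟩
  (2 + u) * ((2 * suc (u + m)) * (b + b))
    ≡⟨ regroup (2 + u) (suc (u + m)) b ⟩
  suc (u + m) * ((4 * (2 + u)) * b)
    ≤⟨ *-monoʳ-≤ (suc (u + m)) (*-monoˡ-≤ b 4[2+u]≤m) ⟩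
  suc (u + m) * (m * b)
    ≡⟨ cong (suc (u + m) *_) ratio ⟨
  suc (u + m) * (suc u * b′)
    ≡⟨ exchange (suc (u + m)) (suc u) b′ ⟩
  suc u * (suc (u + m) * b′)
    ≡⟨ cong (suc u *_) absorb ⟨
  suc u * ((2 + u) * c)
    ≡⟨ exchange (suc u) (2 + u) c ⟩
  (2 + u) * (suc u * c) ∎)
  where
  open ≤-Reasoning
  exchange : ∀ a b c → a * (b * c) ≡ b * (a * c)
  exchange = ℕ-Ring.solve-∀
  regroup : ∀ a n b → a * ((2 * n) * (b + b)) ≡ n * ((4 * a) * b)
  regroup = ℕ-Ring.solve-∀
  double : ∀ N → 2 + N + N ≡ 2 * suc N
  double = ℕ-Ring.solve-∀
  2+N≤2[1+N] : 2 + (u + m) ≤ 2 * suc (u + m)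
  2+N≤2[1+N] = ≤-trans (m≤m+n (2 + (u + m)) (u + m)) (≤-reflexive (double (u + m)))

-- For s = t + 2 and n = N + 2 this controls all but the last two terms of the sum in the bound for
-- the large members.
binomSum-negligible : ∀ N t → 3 * ((2 + t) * (2 + t)) ≤ 2 + N →
                      (2 + N) * binomSum N t ≤ t * (suc N C suc t)
binomSum-negligible N zero _ = ≤-reflexive (*-zeroʳ (2 + N))
binomSum-negligible N (suc u) large = 
  subst (λ N → (2 + N) * binomSum N (suc u) ≤ suc u * (suc N C (2 + u))) N≡
    (two-step-ratio u m (C-ratio u m) (C-absorb (u + m) (suc u))
      (<⇒≤ (binomSum<C (u + m) u (subst (λ N → 3 * u ≤ suc N) (sym N≡) 3u≤1+N)))
      (+-cancelˡ-≤ u _ _ (subst (u + 4 * (2 + u) ≤_) (sym N≡) u+4[2+u]≤N)))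
  where
  expand : ∀ u → 3 * ((3 + u) * (3 + u)) ≡ 2 + (u + 4 * (2 + u) + (17 + 13 * u + 3 * (u * u)))
  expand = ℕ-Ring.solve-∀
  u+4[2+u]≤N : u + 4 * (2 + u) ≤ N
  u+4[2+u]≤N = m+n≤o⇒m≤o (u + 4 * (2 + u)) (+-cancelˡ-≤ 2 _ _ (subst (_≤ 2 + N) (expand u) large))
  expand′ : ∀ u → 3 * ((3 + u) * (3 + u)) ≡ suc (3 * u) + (26 + 15 * u + 3 * (u * u))
  expand′ = ℕ-Ring.solve-∀
  3u≤1+N : 3 * u ≤ suc N
  3u≤1+N = s≤s⁻¹ (m+n≤o⇒m≤o (suc (3 * u)) (subst (_≤ 2 + N) (expand′ u) large))
  m = N ∸ u
  N≡ : u + m ≡ N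
  N≡ = m+[n∸m]≡n (m+n≤o⇒m≤o u u+4[2+u]≤N)

-- The slack comes from (n/s) C(n-1, s-1) = C(n, s), which n ≥ 3s² makes at least 3s C(n-1, s-1).
smallAndLarge<C : ∀ N s → 1 ≤ s → 3 * (s * s) ≤ 2 + N →
                  suc s * binomSum (suc N) s + (2 + N) * binomSum N s < suc s * ((2 + N) C s)
smallAndLarge<C zero 1 _ (s≤s (s≤s ()))
smallAndLarge<C (suc N) 1 _ _ = begin-strict
  2 + (3 + N) * 1        ≡⟨ cong (2 +_) (*-identityʳ (3 + N)) ⟩
  2 + (3 + N)            <⟨ +-monoˡ-< (3 + N) (s≤s (s≤s (s≤s z≤n))) ⟩
  (3 + N) + (3 + N)      ≡⟨ cong ((3 + N) +_) (+-identityʳ (3 + N)) ⟨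
  2 * (3 + N)            ≡⟨ cong (2 *_) (nC1≡n (3 + N)) ⟨
  2 * ((3 + N) C 1)      ∎
  where open ≤-Reasoning
smallAndLarge<C N (suc (suc t)) _ large = begin-strict
  (3 + t) * (binomSum (suc N) (suc t) + c) + (2 + N) * (binomSum N t + N C t + N C suc t)
    <⟨ +-monoˡ-< _ (*-monoʳ-< (3 + t) (+-monoˡ-< c (binomSum<C (suc N) (suc t) 3[1+t]≤2+N))) ⟩
  (3 + t) * (c + c) + (2 + N) * (binomSum N t + N C t + N C suc t)
    ≡⟨ cong (λ z → (3 + t) * (c + c) + (2 + N) * z)
         (trans (+-assoc (binomSum N t) (N C t) (N C suc t)) (cong (binomSum N t +_) (nCk+nC[k+1]≡[n+1]C[k+1] N t))) ⟩
  (3 + t) * (c + c) + (2 + N) * (binomSum N t + c)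
    ≡⟨ cong ((3 + t) * (c + c) +_) (*-distribˡ-+ (2 + N) (binomSum N t) c) ⟩
  (3 + t) * (c + c) + ((2 + N) * binomSum N t + (2 + N) * c)
    ≤⟨ +-monoʳ-≤ ((3 + t) * (c + c)) (+-monoˡ-≤ ((2 + N) * c) (binomSum-negligible N t large)) ⟩
  -- Here s = t + 2, c = C(n-1, s-1) and x = C(n, s). The coefficients 2(s+1) and s - 2 of c add up
  -- to 3s, which costs at most one x; the remaining n·c is exactly s·x.
  (3 + t) * (c + c) + (t * c + (2 + N) * c)
    ≡⟨ regroup t c ((2 + N) * c) ⟩
  3 * (2 + t) * c + (2 + N) * c
    ≤⟨ +-monoˡ-≤ ((2 + N) * c) 3[2+t]c≤x ⟩
  x + (2 + N) * c
    ≡⟨ cong (x +_) (C-absorb (suc N) (suc t)) ⟨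
  (3 + t) * x ∎
  where
  open ≤-Reasoning
  c = suc N C suc t
  x = (2 + N) C (2 + t)
  regroup : ∀ t c d → (3 + t) * (c + c) + (t * c + d) ≡ 3 * (2 + t) * c + d
  regroup = ℕ-Ring.solve-∀
  assoc : ∀ a c → a * (3 * a * c) ≡ 3 * (a * a) * c
  assoc = ℕ-Ring.solve-∀
  3[2+t]c≤x : 3 * (2 + t) * c ≤ x
  3[2+t]c≤x = *-cancelˡ-≤ (2 + t) (begin
    (2 + t) * (3 * (2 + t) * c)     ≡⟨ assoc (2 + t) c ⟩
    3 * ((2 + t) * (2 + t)) * c     ≤⟨ *-monoˡ-≤ c large ⟩
    (2 + N) * c                     ≡⟨ C-absorb (suc N) (suc t) ⟨
    (2 + t) * x                     ∎)
  expand : ∀ t → 3 * ((2 + t) * (2 + t)) ≡ 3 * suc t + (9 + 9 * t + 3 * (t * t))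
  expand = ℕ-Ring.solve-∀
  3[1+t]≤2+N : 3 * suc t ≤ 2 + N
  3[1+t]≤2+N = m+n≤o⇒m≤o (3 * suc t) (subst (_≤ 2 + N) (expand t) large)

-- The strict bound when some l ∈ L is at least s

sum-const-1 : ∀ {X : Set} (xs : List X) → sum (map (const 1) xs) ≡ length xs
sum-const-1 [] = refl
sum-const-1 (x ∷ xs) = cong suc (sum-const-1 xs)

-- Each member lies in more than `s` links. A link lives on 1 + N points, and its intersection sizes
-- are the positive elements of `L` lowered by one; the loss of 0 shortens the binomial sum by a
-- term.
largeSetsBound : ∀ {N} s L (F : List (Subset (2 + N))) → 0 ∈ L → AllPairs (SpernerPair (_∈ L)) F →
                 All (λ A → s < ∣ A ∣) F → suc s * length F ≤ (2 + N) * binomSum N (length L)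
largeSetsBound {N} s L F 0∈L sperner large = begin
  suc s * length F                        ≡⟨ *-comm (suc s) (length F) ⟩
  length F * suc s                        ≤⟨ length*≤sum (λ A → ∣ A ∣ * 1) (suc s) F
                                               (All.map (λ {A} s<∣A∣ → ≤-trans s<∣A∣ (≤-reflexive (sym (*-identityʳ ∣ A ∣)))) large) ⟩
  sum (map (λ A → ∣ A ∣ * 1) F)           ≡⟨ doubleCount (const 1) F ⟩
  ∑ (λ j → sum (map (const 1) (filter (contains? j) F)))
                                          ≤⟨ ∑-≤ linkBound ⟩
  (2 + N) * binomSum N (length L)         ∎
  where
  open ≤-Reasoning
  positive = filter (0 <?_) L
  L⁻ = map pred positive

  linkBound : ∀ j → sum (map (const 1) (filter (contains? j) F)) ≤ binomSum N (length L)
  linkBound j = begin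
    sum (map (const 1) (filter (contains? j) F))
      ≡⟨ sum-const-1 (filter (contains? j) F) ⟩
    length (filter (contains? j) F)
      ≡⟨ length-map _ (filter (contains? j) F) ⟨
    length (link j F)
      ≤⟨ polynomialBound L⁻ (link j F)
           (link-sperner {K = _∈ L} {K′ = _∈ L⁻}
             (λ 1+k∈L → ∈-map⁺ pred (∈-filter⁺ (0 <?_) 1+k∈L (s≤s z≤n))) j F sperner) ⟩
    binomSum N (suc (length L⁻))
      ≡⟨ cong (binomSum N ∘ suc) (length-map pred positive) ⟩
    binomSum N (suc (length positive))
      ≤⟨ binomSum-mono N (filter-notAll (0 <?_) L (lose 0∈L λ ())) ⟩
    binomSum N (length L) ∎

-- By the Sperner condition, distinct members of size at most `s` meet in fewer than `s` points, so
-- the value l ≥ s never occurs and can be struck from `L`.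
smallSetsBound : ∀ {N} s L (F : List (Subset (suc N))) → ∀ {l} → l ∈ L → s ≤ l →
                 AllPairs (SpernerPair (_∈ L)) F → All (λ A → ∣ A ∣ ≤ s) F →
                 length F ≤ binomSum N (length L)
smallSetsBound {N} s L F l∈L s≤l sperner small = ≤-trans
  (polynomialBound (filter (_<? s) L) F
    (AllPairs.map (λ (∣A∣≤s , _ , ∈L , <A , <B) → ∈-filter⁺ (_<? s) ∈L (<-≤-trans <A ∣A∣≤s) , <A , <B)
      (AllPairs-restrict small sperner)))
  (binomSum-mono N (filter-notAll (_<? s) L (lose l∈L (≤⇒≯ s≤l))))

strictBound : ∀ n L (F : List (Subset n)) → let s = length L in 1 ≤ s → 3 * (s * s) ≤ n →
              0 ∈ L → ∀ {l} → l ∈ L → s ≤ l → AllPairs (SpernerPair (_∈ L)) F → length F < n C s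
strictBound n L F 1≤s large 0∈L l∈L s≤l sperner
  -- From s ≥ 1 follows n ≥ 3s² ≥ 3, so n has the form 2 + N.
  with m≤n⇒∃[o]m+o≡n (≤-trans (≤-trans (n≤1+n 2) (*-monoʳ-≤ 3 (*-mono-≤ 1≤s 1≤s))) large)
... | N , refl = *-cancelˡ-< (suc s) (length F) _ (begin-strict
  suc s * length F
    ≡⟨ cong (suc s *_) (length-filter-∁ small? F) ⟩
  suc s * (length (filter small? F) + length (filter (¬? ∘ small?) F))
    ≡⟨ *-distribˡ-+ (suc s) (length (filter small? F)) _ ⟩
  suc s * length (filter small? F) + suc s * length (filter (¬? ∘ small?) F)
    ≤⟨ +-mono-≤
         (*-monoʳ-≤ (suc s) (smallSetsBound s L (filter small? F) l∈L s≤l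
           (AllPairs.filter⁺ small? sperner) (All.all-filter small? F)))
         (largeSetsBound s L (filter (¬? ∘ small?) F) 0∈L
           (AllPairs.filter⁺ (¬? ∘ small?) sperner) (All.map ≰⇒> (All.all-filter (¬? ∘ small?) F))) ⟩
  suc s * binomSum (suc N) s + (2 + N) * binomSum N s
    <⟨ smallAndLarge<C N s 1≤s large ⟩
  suc s * ((2 + N) C s) ∎)
  where
  open ≤-Reasoning
  s = length L
  small? : Decidable (λ (A : Subset (2 + N)) → ∣ A ∣ ≤ s)
  small? A = ∣ A ∣ ≤? s

-- Both bounds and the characterization of equality

theorem1p4 : (n s : ℕ) → 1 ≤ n → 1 ≤ s →
    (L : List ℕ) → Unique L → length L ≡ s →
    (F : List (Subset n)) → Unique F → LIntersecting L F → Sperner F →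
    (length F ≤ sumBinom (n ∸ 1) s)
    × (0 ∈ L → 3 * (s * s) ≤ n →
    (length F ≤ n C s)
    × (length F ≡ n C s ⇔
    ((∀ x → (x ∈ L ⇔ x < s)) × (∀ A → (A ∈ F ⇔ ∣ A ∣ ≡ s)))))
theorem1p4 n s 1≤n 1≤s L unique-L refl F unique-F intersecting sperner = part₁ 1≤n F pairs , part₂
  where
  pairs : AllPairs (SpernerPair (_∈ L)) F
  pairs = AllPairs.map
    (λ {A} {B} (A∈F , B∈F , A≢B) →
      intersecting A∈F B∈F A≢B ,
      ⊈⇒∣∩∣< A B (sperner A∈F B∈F A≢B) ,
      subst (_< ∣ B ∣) (cong ∣_∣ (∩-comm B A)) (⊈⇒∣∩∣< B A (sperner B∈F A∈F (A≢B ∘ sym))))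
    (AllPairs-restrict (All.tabulate id) unique-F)

  part₁ : ∀ {n} → 1 ≤ n → (F : List (Subset n)) → AllPairs (SpernerPair (_∈ L)) F →
          length F ≤ sumBinom (n ∸ 1) s
  part₁ {suc n} _ F pairs = ≤-trans (polynomialBound L F pairs) (≤-reflexive (sym (sumBinom≡binomSum n s)))

  part₂ : 0 ∈ L → 3 * (s * s) ≤ n →
          (length F ≤ n C s) ×
          (length F ≡ n C s ⇔ ((∀ x → (x ∈ L ⇔ x < s)) × (∀ A → (A ∈ F ⇔ ∣ A ∣ ≡ s))))
  part₂ 0∈L 3s²≤n with All.all? (_<? s) L
  ... | no ¬L<s =
    let (l , l∈L , l≮s) = find (All.¬All⇒Any¬ (_<? s) L ¬L<s)
        strict = strictBound n L F 1≤s 3s²≤n 0∈L l∈L (≮⇒≥ l≮s) pairs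
    in <⇒≤ strict ,
       mk⇔ (λ tight → contradiction tight (<⇒≢ strict))
           (λ (L⇔ , _) → contradiction (Equivalence.to (L⇔ l) l∈L) l≮s)
  ... | yes L<s = lymBound 1≤s 2s≤n F pairs< , mk⇔ extremal (λ (_ , F⇔) → full F⇔)
    where
    2s≤n : s + s ≤ n
    2s≤n = ≤-trans (≤-trans (≤-reflexive (cong (s +_) (sym (+-identityʳ s))))
             (*-mono-≤ {2} {3} (n≤1+n 2) (m≤m*n s s {{>-nonZero 1≤s}}))) 3s²≤n

    pairs< : AllPairs (SpernerPair (_< s)) F
    pairs< = AllPairs.map (λ (∈L , <A , <B) → All.lookup L<s ∈L , <A , <B) pairs

    open DecMembership ℕ._≟_ renaming (_∈?_ to _∈ᴸ?_) using ()
    open DecMembership (≡-dec {n = n} Bool._≟_) renaming (_∈?_ to _∈ᶠ?_) using ()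

    -- A missing x < s together with `L` would give s + 1 distinct numbers below `s`.
    L-full : ∀ {x} → x < s → ¬ (x ∉ L)
    L-full {x} x<s x∉L = 1+n≰n (≤-trans
      (Unique-⊆-length (All.tabulate (λ { y∈L refl → x∉L y∈L }) ∷ unique-L)
        (λ { (here refl) → ∈-upTo⁺ x<s ; (there y∈L) → ∈-upTo⁺ (All.lookup L<s y∈L) }))
      (≤-reflexive (length-upTo s)))

    extremal : length F ≡ n C s → (∀ x → (x ∈ L ⇔ x < s)) × (∀ A → (A ∈ F ⇔ ∣ A ∣ ≡ s))
    extremal tight =
      (λ x → mk⇔ (All.lookup L<s) (λ x<s → decidable-stable (x ∈ᴸ? L) (L-full x<s))) ,
      (λ A → mk⇔ (lymBound-uniform 1≤s 2s≤n F pairs< tight)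
                 (λ ∣A∣≡s → decidable-stable (A ∈ᶠ? F) (lymBound-full 1≤s 2s≤n F pairs< tight A ∣A∣≡s)))

    -- The duplicate-free list of all s-sets is contained in `F`, which gives the lower bound C(n,
    -- s).
    full : (∀ A → (A ∈ F ⇔ ∣ A ∣ ≡ s)) → length F ≡ n C s
    full F⇔ = ≤-antisym (lymBound 1≤s 2s≤n F pairs<)
      (≤-trans (≤-reflexive (sym (length-uniformSets n s)))
        (Unique-⊆-length (uniformSets-unique n s)
          (λ {A} A∈ → Equivalence.from (F⇔ A) (All.lookup (uniformSets-size n s) A∈))))
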